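{- Let $G$ be the path $P_n$ or the cycle $C_n$ with $n\geq 3$, and let $c_0:V(G)\to\mathbb{Z}$ be any initial chip configuration. Then the sequence of configurations $(c_t)_{t\geq 0}$ produced by the diffusion process is eventually periodic, i.e. there exist integers $t\geq 0$ and $p\geq 1$ with $c_{t+p}=c_t$.
   Context: Diffusion process: for a finite simple graph $G$ and a chip configuration $c_t:V(G)\to\mathbb{Z}$ (negative values allowed), the next configuration is defined simultaneously for every vertex $u$ by $c_{t+1}(u)=c_t(u)-|\{w\in N(u): c_t(u)>c_t(w)\}|+|\{w\in N(u): c_t(u)<c_t(w)\}|$. That is, every vertex sends one chip to each neighbour having strictly fewer chips. -}

module Defs where

open import Data.Empty using (⊥)
open import Data.Fin.Base using (Fin; toℕ)
open import Data.Integer.Base as ℤ using (ℤ; +_)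
import Data.Integer.Properties as ℤ
open import Data.List.Base using (List; allFin; filter; length)
open import Data.Nat.Base using (ℕ; zero; suc; _≤_; s≤s)
open import Data.Nat.Properties using (_≟_; 1+n≢n)
open import Data.Product.Base using (_×_; _,_)
open import Data.Sum.Base using (_⊎_; inj₁; inj₂; swap)
open import Relation.Binary.Definitions using (Decidable; Symmetric; Irreflexive)
open import Relation.Binary.PropositionalEquality using (_≡_; refl; sym; trans; cong)
open import Relation.Nullary.Decidable using (_⊎-dec_; _×-dec_)

record SimpleGraph (n : ℕ) : Set₁ where
  field
    Adj        : Fin n → Fin n → Set
    adj?       : Decidable Adj
    adj-sym    : Symmetric Adj
    adj-irrefl : Irreflexive _≡_ Adj

  neighbours : Fin n → List (Fin n)
  neighbours u = filter (adj? u) (allFin n)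

open SimpleGraph public using (neighbours)

LinSucc : ∀ {n} → Fin n → Fin n → Set
LinSucc u w = suc (toℕ u) ≡ toℕ w

-- Equivalently, suc (toℕ u) is congruent to toℕ w modulo n.
CycSucc : ∀ {n} → Fin n → Fin n → Set
CycSucc {n} u w = LinSucc u w ⊎ (suc (toℕ u) ≡ n × toℕ w ≡ 0)

linSucc? : ∀ {n} → Decidable (LinSucc {n})
linSucc? u w = suc (toℕ u) ≟ toℕ w

cycSucc? : ∀ {n} → Decidable (CycSucc {n})
cycSucc? {n} u w = linSucc? u w ⊎-dec ((suc (toℕ u) ≟ n) ×-dec (toℕ w ≟ 0))

cycSucc-irrefl : ∀ {n} → 3 ≤ n → (u : Fin n) → CycSucc u u → ⊥
cycSucc-irrefl _   u (inj₁ e) = 1+n≢n e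
cycSucc-irrefl 3≤n u (inj₂ (e , z)) with trans (sym e) (cong suc z)
cycSucc-irrefl (s≤s ()) u (inj₂ (e , z)) | refl

path : (n : ℕ) → SimpleGraph n
path n = record
  { Adj        = λ u w → LinSucc u w ⊎ LinSucc w u
  ; adj?       = λ u w → linSucc? u w ⊎-dec linSucc? w u
  ; adj-sym    = swap
  ; adj-irrefl = λ { refl (inj₁ e) → 1+n≢n e ; refl (inj₂ e) → 1+n≢n e }
  }

cycle : (n : ℕ) → 3 ≤ n → SimpleGraph n
cycle n 3≤n = record
  { Adj        = λ u w → CycSucc u w ⊎ CycSucc w u
  ; adj?       = λ u w → cycSucc? u w ⊎-dec cycSucc? w u
  ; adj-sym    = swap
  ; adj-irrefl = λ { {u} refl (inj₁ s) → cycSucc-irrefl 3≤n u s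
                   ; {u} refl (inj₂ s) → cycSucc-irrefl 3≤n u s }
  }

data PathOrCycle : ∀ {n} → SimpleGraph n → Set where
  isPath  : ∀ {n} → 1 ≤ n → PathOrCycle (path n)
  isCycle : ∀ {n} (3≤n : 3 ≤ n) → PathOrCycle (cycle n 3≤n)

Config : ℕ → Set
Config n = Fin n → ℤ

-- neighbours G u has no repetitions, so the lengths below are cardinalities.
poorer richer : ∀ {n} → SimpleGraph n → Config n → Fin n → ℕ
poorer G c u = length (filter (λ w → c w ℤ.<? c u) (neighbours G u))
richer G c u = length (filter (λ w → c u ℤ.<? c w) (neighbours G u))

step : ∀ {n} → SimpleGraph n → Config n → Config n
step G c u = c u ℤ.- + poorer G c u ℤ.+ + richer G c u

diffusion : ∀ {n} → SimpleGraph n → Config n → ℕ → Config n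
diffusion G c₀ zero    = c₀
diffusion G c₀ (suc t) = step G (diffusion G c₀ t)

{-# OPTIONS --safe #-}

-- Let E(c) = Σ c(u)² and let d(u) be the change at u. Pairing the two directions of every edge gives
-- E(c + d) + Σ |c(u) − c(w)| = E(c) + Σ d(u)², the sum of gaps running over ordered adjacent pairs.
-- Since |d(u)| ≤ n, the energy can only increase when all gaps along edges are below n³; as the graph
-- contains a Hamiltonian path and the total number of chips is conserved, this leaves a bounded
-- region. So the energy is bounded along the orbit, and the pigeonhole principle gives a repetition.
module Submission where

open import Defs
open import Data.Bool.Base using (true; false; if_then_else_)
open import Data.Fin.Base using (Fin; zero; suc; toℕ; fromℕ<; funToFin; finToFun)
open import Data.Fin.Properties using (toℕ<n; fromℕ<-injective; finToFun-funToFin; pigeonhole)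
open import Data.Integer.Base as ℤ using (ℤ; +_; 0ℤ; 1ℤ; ∣_∣; +≤+)
import Data.Integer.Properties as ℤ
open import Data.Integer.Tactic.RingSolver using (solve-∀)
open import Data.List.Base using (filter; length; tabulate)
open import Data.Nat.Base using (ℕ; zero; suc; _+_; _*_; _^_; _⊔_; _∸_; _≤_; _<_; _≥_; z≤n; s≤s)
import Data.Nat.Properties as ℕ
open import Data.Product.Base using (_×_; _,_; ∃-syntax)
open import Data.Sum.Base using (_⊎_; inj₁; inj₂)
open import Function.Base using (_∘_; id; const)
open import Relation.Binary.PropositionalEquality
  using (_≡_; _≗_; refl; sym; trans; cong; cong₂; subst; subst₂; module ≡-Reasoning)
open import Relation.Nullary.Decidable using (Dec; yes; no; does; dec-true)
open import Relation.Nullary.Negation using (contradiction)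
open import Relation.Unary using (Pred) renaming (Decidable to Decidable₁)

open import Algebra.Properties.AbelianGroup ℤ.+-0-abelianGroup using (//-rightDividesʳ) renaming (∙-cancelʳ to +-cancelʳ)
open import Algebra.Properties.Semiring.Sum ℤ.+-*-semiring
  using (sum; sum-cong-≗; ∑-distrib-+; ∑-comm; *-distribˡ-sum)

open SimpleGraph using (Adj; adj?; adj-sym)

-- Finite sums and integer inequalities.

0≤sum : ∀ {n} {f : Fin n → ℤ} → (∀ i → 0ℤ ℤ.≤ f i) → 0ℤ ℤ.≤ sum f
0≤sum {zero}  0≤f = ℤ.≤-refl
0≤sum {suc n} 0≤f = ℤ.+-mono-≤ (0≤f zero) (0≤sum (0≤f ∘ suc))

term≤sum : ∀ {n} (f : Fin n → ℤ) → (∀ i → 0ℤ ℤ.≤ f i) → ∀ i → f i ℤ.≤ sum f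
term≤sum f 0≤f zero    = subst (ℤ._≤ sum f) (ℤ.+-identityʳ _)
  (ℤ.+-monoʳ-≤ (f zero) (0≤sum (0≤f ∘ suc)))
term≤sum f 0≤f (suc i) = subst (ℤ._≤ sum f) (ℤ.+-identityˡ _)
  (ℤ.+-mono-≤ (0≤f zero) (term≤sum (f ∘ suc) (0≤f ∘ suc) i))

∣sum∣≤ : ∀ {n b} (f : Fin n → ℤ) → (∀ i → ∣ f i ∣ ≤ b) → ∣ sum f ∣ ≤ n * b
∣sum∣≤ {zero}  f f≤b = z≤n
∣sum∣≤ {suc n} f f≤b = ℕ.≤-trans (ℤ.∣i+j∣≤∣i∣+∣j∣ (f zero) _)
  (ℕ.+-mono-≤ (f≤b zero) (∣sum∣≤ (f ∘ suc) (f≤b ∘ suc)))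

sum-const : ∀ n x → sum {n} (const x) ≡ + n ℤ.* x
sum-const zero    x = sym (ℤ.*-zeroˡ x)
sum-const (suc n) x = trans (cong (λ y → x ℤ.+ y) (sum-const n x)) (sym (ℤ.suc-* (+ n) x))

sum-zero : ∀ n → sum {n} (const 0ℤ) ≡ 0ℤ
sum-zero n = trans (sum-const n 0ℤ) (ℤ.*-zeroʳ (+ n))

i≤+∣i∣ : ∀ i → i ℤ.≤ + ∣ i ∣
i≤+∣i∣ (+ n)      = ℤ.≤-refl
i≤+∣i∣ ℤ.-[1+ n ] = ℤ.-≤+

0≤i*i : ∀ i → 0ℤ ℤ.≤ i ℤ.* i
0≤i*i (+ n)      = subst (0ℤ ℤ.≤_) (ℤ.pos-* n n) (+≤+ z≤n)
0≤i*i ℤ.-[1+ n ] = +≤+ z≤n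

+-cancelʳ-≤ : ∀ k {i j} → i ℤ.+ k ℤ.≤ j ℤ.+ k → i ℤ.≤ j
+-cancelʳ-≤ k {i} {j} i+k≤j+k = subst₂ ℤ._≤_ (//-rightDividesʳ k i) (//-rightDividesʳ k j)
  (ℤ.+-monoˡ-≤ (ℤ.- k) i+k≤j+k)

i+i≡0⇒i≡0 : ∀ i → i ℤ.+ i ≡ 0ℤ → i ≡ 0ℤ
i+i≡0⇒i≡0 (+ zero) _ = refl

m≤m*m : ∀ m → m ≤ m * m
m≤m*m zero    = z≤n
m≤m*m (suc m) = ℕ.m≤m+n (suc m) _

-- Indicators and the sign of a difference.

indicator : ∀ {A : Set} → Dec A → ℤ
indicator a? = if does a? then 1ℤ else 0ℤ

indicator-cong : ∀ {A B : Set} (a? : Dec A) (b? : Dec B) → (A → B) → (B → A) →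
  indicator a? ≡ indicator b?
indicator-cong (yes _) (yes _) _ _ = refl
indicator-cong (no _)  (no _)  _ _ = refl
indicator-cong (yes a) (no ¬b) f _ = contradiction (f a) ¬b
indicator-cong (no ¬a) (yes b) _ g = contradiction (g b) ¬a

-- Turns the cardinalities in `poorer` and `richer` into sums of 0/1 products, open to algebra. The
-- list is `tabulate g` for arbitrary `g`, since the induction replaces `g` by `g ∘ suc`; `allFin`
-- is the case `id`.
length-filter² : ∀ {n} {A : Set} {P Q : Pred A _} (P? : Decidable₁ P) (Q? : Decidable₁ Q) (g : Fin n → A) →
  + length (filter P? (filter Q? (tabulate g))) ≡ sum (λ i → indicator (Q? (g i)) ℤ.* indicator (P? (g i)))
length-filter² {zero}  P? Q? g = refl
length-filter² {suc n} P? Q? g with does (Q? (g zero))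
... | false = trans (length-filter² P? Q? (g ∘ suc)) (sym (ℤ.+-identityˡ _))
... | true with does (P? (g zero))
...   | false = trans (length-filter² P? Q? (g ∘ suc)) (sym (ℤ.+-identityˡ _))
...   | true  = cong (λ x → 1ℤ ℤ.+ x) (length-filter² P? Q? (g ∘ suc))

-- The sign of `j - i`, that is, the chips a vertex of height `i` gains from a neighbour of height
-- `j`.
comparison : ℤ → ℤ → ℤ
comparison i j = indicator (i ℤ.<? j) ℤ.- indicator (j ℤ.<? i)

-- A view indexed by the value of `comparison i j`, so that matching on it replaces the difference
-- of indicators by a literal.
data Comparison (i j : ℤ) : ℤ → Set where
  less    : i ℤ.< j → Comparison i j 1ℤ
  equal   : i ≡ j   → Comparison i j 0ℤ
  greater : j ℤ.< i → Comparison i j ℤ.-1ℤ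

compareℤ : ∀ i j → Comparison i j (comparison i j)
compareℤ i j with i ℤ.<? j | j ℤ.<? i
... | yes i<j | yes j<i = contradiction j<i (ℤ.<-asym i<j)
... | yes i<j | no  _   = less i<j
... | no  _   | yes j<i = greater j<i
... | no  i≮j | no  j≮i = equal (ℤ.≤-antisym (ℤ.≮⇒≥ j≮i) (ℤ.≮⇒≥ i≮j))

∣comparison∣≤1 : ∀ i j → ∣ comparison i j ∣ ≤ 1
∣comparison∣≤1 i j with comparison i j | compareℤ i j
... | _ | less _    = ℕ.≤-refl
... | _ | equal _   = z≤n
... | _ | greater _ = ℕ.≤-refl

-- Chips run downhill: `comparison i j` has the sign opposite to `i - j`, so the product is minus
-- the absolute value. This is the source of dissipation.
gap-comparison : ∀ i j → (i ℤ.- j) ℤ.* comparison i j ≡ ℤ.- (+ ∣ i ℤ.- j ∣)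
gap-comparison i j with comparison i j | compareℤ i j
... | _ | less i<j    = trans (ℤ.*-identityʳ _)
  (trans (sym (neg-diff i j)) (cong ℤ.-_ (sym (ℤ.∣-∣-≤ (ℤ.<⇒≤ i<j)))))
  where
  neg-diff : ∀ i j → ℤ.- (j ℤ.- i) ≡ i ℤ.- j
  neg-diff = solve-∀
... | _ | equal refl  rewrite ℤ.+-inverseʳ i = refl
... | _ | greater j<i = trans (ℤ.*-comm _ ℤ.-1ℤ) (trans (ℤ.-1*i≡-i _)
  (cong ℤ.-_ (sym (trans (cong +_ (ℤ.∣i-j∣≡∣j-i∣ i j)) (ℤ.∣-∣-≤ (ℤ.<⇒≤ j<i))))))

-- Antisymmetric flows and summation by parts.

module Antisymmetric {n} (f : Fin n → Fin n → ℤ) (antisym : ∀ u w → f u w ≡ ℤ.- f w u) where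

  out : Fin n → ℤ
  out u = sum (f u)

  -- Exchanging the order of summation in the second copy turns it into a sum of `c w * f w u`; by
  -- antisymmetry it merges with `c u * f u w`.
  weighted-sum : ∀ (c : Fin n → ℤ) →
    sum (λ u → c u ℤ.* out u) ℤ.+ sum (λ u → c u ℤ.* out u)
      ≡ sum (λ u → sum (λ w → (c u ℤ.- c w) ℤ.* f u w))
  weighted-sum c = begin
    X ℤ.+ X
      ≡⟨ cong₂ ℤ._+_ X≡ (trans X≡ (∑-comm (λ u w → c u ℤ.* f u w))) ⟩
    sum (λ u → sum (λ w → c u ℤ.* f u w)) ℤ.+ sum (λ u → sum (λ w → c w ℤ.* f w u))
      ≡⟨ ∑-distrib-+ (λ u → sum (λ w → c u ℤ.* f u w)) _ ⟨
    sum (λ u → sum (λ w → c u ℤ.* f u w) ℤ.+ sum (λ w → c w ℤ.* f w u))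
      ≡⟨ sum-cong-≗ (λ u → ∑-distrib-+ (λ w → c u ℤ.* f u w) _) ⟨
    sum (λ u → sum (λ w → c u ℤ.* f u w ℤ.+ c w ℤ.* f w u))
      ≡⟨ sum-cong-≗ (λ u → sum-cong-≗ (λ w → pair u w)) ⟩
    sum (λ u → sum (λ w → (c u ℤ.- c w) ℤ.* f u w)) ∎
    where
    open ≡-Reasoning
    X : ℤ
    X = sum (λ u → c u ℤ.* out u)
    X≡ : X ≡ sum (λ u → sum (λ w → c u ℤ.* f u w))
    X≡ = sum-cong-≗ (λ u → *-distribˡ-sum (c u) (f u))
    factor : ∀ x y z → x ℤ.* ℤ.- z ℤ.+ y ℤ.* z ≡ (x ℤ.- y) ℤ.* ℤ.- z
    factor = solve-∀
    pair : ∀ u w → c u ℤ.* f u w ℤ.+ c w ℤ.* f w u ≡ (c u ℤ.- c w) ℤ.* f u w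
    pair u w rewrite antisym u w = factor (c u) (c w) (f w u)

  -- With all weights 1 in `weighted-sum` every difference vanishes, so twice the total is zero.
  total≡0 : sum out ≡ 0ℤ
  total≡0 = i+i≡0⇒i≡0 _ (begin
    sum out ℤ.+ sum out
      ≡⟨ cong₂ ℤ._+_ (sum-cong-≗ 1*out) (sum-cong-≗ 1*out) ⟨
    sum (λ u → 1ℤ ℤ.* out u) ℤ.+ sum (λ u → 1ℤ ℤ.* out u)
      ≡⟨ weighted-sum (λ _ → 1ℤ) ⟩
    sum {n} (λ u → sum {n} (const 0ℤ))
      ≡⟨ sum-cong-≗ {n} (λ _ → sum-zero n) ⟩
    sum {n} (const 0ℤ)
      ≡⟨ sum-zero n ⟩
    0ℤ ∎)
    where
    open ≡-Reasoning
    1*out : ∀ u → 1ℤ ℤ.* out u ≡ out u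
    1*out u = ℤ.*-identityˡ (out u)

-- Energy against pointwise bounds.

energy : ∀ {n} → Config n → ℤ
energy c = sum (λ u → c u ℤ.* c u)

-- An integer is at most its square in absolute value, and a single square is at most the sum of all
-- squares.
∣c∣≤energy : ∀ {n M} (c : Config n) → energy c ℤ.≤ + M → ∀ u → ∣ c u ∣ ≤ M
∣c∣≤energy {M = M} c E≤M u = ℕ.≤-trans (m≤m*m ∣ c u ∣) (ℤ.drop‿+≤+ (begin
  + (∣ c u ∣ * ∣ c u ∣)  ≡⟨ cong +_ (ℤ.abs-* (c u) (c u)) ⟨
  + ∣ c u ℤ.* c u ∣      ≡⟨ ℤ.0≤i⇒+∣i∣≡i (0≤i*i (c u)) ⟩
  c u ℤ.* c u            ≤⟨ term≤sum (λ v → c v ℤ.* c v) (λ v → 0≤i*i (c v)) u ⟩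
  energy c               ≤⟨ E≤M ⟩
  + M                    ∎))
  where open ℤ.≤-Reasoning

energy≤ : ∀ {n b} (c : Config n) → (∀ u → ∣ c u ∣ ≤ b) → energy c ℤ.≤ + (n * (b * b))
energy≤ {b = b} c c≤b = ℤ.≤-trans (i≤+∣i∣ _) (+≤+ (∣sum∣≤ (λ u → c u ℤ.* c u)
  (λ u → subst (_≤ b * b) (sym (ℤ.abs-* (c u) (c u))) (ℕ.*-mono-≤ (c≤b u) (c≤b u)))))

-- One diffusion step: conservation and energy balance.

module Step {n} (G : SimpleGraph n) (c : Config n) where

  adjacency : Fin n → Fin n → ℤ
  adjacency u w = indicator (adj? G u w)

  -- The net number of chips that `u` receives from `w` in one step.
  flow : Fin n → Fin n → ℤ
  flow u w = adjacency u w ℤ.* comparison (c u) (c w)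

  flow-antisym : ∀ u w → flow u w ≡ ℤ.- flow w u
  flow-antisym u w
    rewrite indicator-cong (adj? G u w) (adj? G w u) (adj-sym G) (adj-sym G)
    = swap (adjacency w u) (indicator (c u ℤ.<? c w)) (indicator (c w ℤ.<? c u))
    where
    swap : ∀ a x y → a ℤ.* (x ℤ.- y) ≡ ℤ.- (a ℤ.* (y ℤ.- x))
    swap = solve-∀

  open Antisymmetric flow flow-antisym public renaming (out to change)

  step-change : ∀ u → step G c u ≡ c u ℤ.+ change u
  step-change u = begin
    c u ℤ.- + poorer G c u ℤ.+ + richer G c u
      ≡⟨ cong₂ (λ x y → c u ℤ.- x ℤ.+ y) (length-filter² _ (adj? G u) id) (length-filter² _ (adj? G u) id) ⟩
    c u ℤ.- p ℤ.+ r
      ≡⟨ regroup (c u) p r ⟩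
    c u ℤ.+ (r ℤ.+ ℤ.-1ℤ ℤ.* p)
      ≡⟨ cong (λ x → c u ℤ.+ (r ℤ.+ x)) (*-distribˡ-sum ℤ.-1ℤ (λ w → adjacency u w ℤ.* indicator (c w ℤ.<? c u))) ⟩
    c u ℤ.+ (r ℤ.+ sum (λ w → ℤ.-1ℤ ℤ.* (adjacency u w ℤ.* indicator (c w ℤ.<? c u))))
      ≡⟨ cong (λ x → c u ℤ.+ x) (∑-distrib-+ (λ w → adjacency u w ℤ.* indicator (c u ℤ.<? c w)) _) ⟨
    c u ℤ.+ sum (λ w → adjacency u w ℤ.* indicator (c u ℤ.<? c w)
                         ℤ.+ ℤ.-1ℤ ℤ.* (adjacency u w ℤ.* indicator (c w ℤ.<? c u)))
      ≡⟨ cong (λ x → c u ℤ.+ x) (sum-cong-≗ (λ w → factor (adjacency u w) (indicator (c u ℤ.<? c w)) (indicator (c w ℤ.<? c u)))) ⟩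
    c u ℤ.+ change u ∎
    where
    open ≡-Reasoning
    p r : ℤ
    p = sum (λ w → adjacency u w ℤ.* indicator (c w ℤ.<? c u))
    r = sum (λ w → adjacency u w ℤ.* indicator (c u ℤ.<? c w))
    regroup : ∀ x p r → x ℤ.- p ℤ.+ r ≡ x ℤ.+ (r ℤ.+ ℤ.-1ℤ ℤ.* p)
    regroup = solve-∀
    factor : ∀ a x y → a ℤ.* x ℤ.+ ℤ.-1ℤ ℤ.* (a ℤ.* y) ≡ a ℤ.* (x ℤ.- y)
    factor = solve-∀

  sum-step : sum (step G c) ≡ sum c
  sum-step = begin
    sum (step G c)                 ≡⟨ sum-cong-≗ step-change ⟩
    sum (λ u → c u ℤ.+ change u)   ≡⟨ ∑-distrib-+ c change ⟩
    sum c ℤ.+ sum change           ≡⟨ cong (λ x → sum c ℤ.+ x) total≡0 ⟩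
    sum c ℤ.+ 0ℤ                   ≡⟨ ℤ.+-identityʳ _ ⟩
    sum c                          ∎
    where open ≡-Reasoning

  ∣change∣≤n : ∀ u → ∣ change u ∣ ≤ n
  ∣change∣≤n u = subst (∣ change u ∣ ≤_) (ℕ.*-identityʳ n) (∣sum∣≤ (flow u) ∣flow∣≤1)
    where
    ∣flow∣≤1 : ∀ w → ∣ flow u w ∣ ≤ 1
    ∣flow∣≤1 w with does (adj? G u w)
    ... | false = z≤n
    ... | true  = subst (λ x → ∣ x ∣ ≤ 1) (sym (ℤ.*-identityˡ (comparison (c u) (c w)))) (∣comparison∣≤1 (c u) (c w))

  gap : Fin n → Fin n → ℤ
  gap u w = adjacency u w ℤ.* + ∣ c u ℤ.- c w ∣

  -- Each edge counts twice, once per direction, which matches the doubled cross term in the square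
  -- of `c + change`.
  tension : ℤ
  tension = sum (λ u → sum (gap u))

  -- Expanding the squares leaves a doubled cross term; `weighted-sum` rewrites it as a sum over
  -- pairs, which `gap-comparison` cancels against `tension` term by term.
  energy-step : energy (step G c) ℤ.+ tension ≡ energy c ℤ.+ energy change
  energy-step = begin
    energy (step G c) ℤ.+ tension
      ≡⟨ cong (ℤ._+ tension) (sum-cong-≗ expand) ⟩
    sum (λ u → c u ℤ.* c u ℤ.+ change u ℤ.* change u ℤ.+ (c u ℤ.* change u ℤ.+ c u ℤ.* change u)) ℤ.+ tension
      ≡⟨ cong (ℤ._+ tension) (trans
           (∑-distrib-+ (λ u → c u ℤ.* c u ℤ.+ change u ℤ.* change u) _)
           (cong₂ ℤ._+_
             (∑-distrib-+ (λ u → c u ℤ.* c u) _)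
             (trans (∑-distrib-+ (λ u → c u ℤ.* change u) _) (weighted-sum c)))) ⟩
    E ℤ.+ sum (λ u → sum (λ w → (c u ℤ.- c w) ℤ.* flow u w)) ℤ.+ tension
      ≡⟨ ℤ.+-assoc E _ tension ⟩
    E ℤ.+ (sum (λ u → sum (λ w → (c u ℤ.- c w) ℤ.* flow u w)) ℤ.+ tension)
      ≡⟨ cong (λ x → E ℤ.+ x) (∑-distrib-+ (λ u → sum (λ w → (c u ℤ.- c w) ℤ.* flow u w)) _) ⟨
    E ℤ.+ sum (λ u → sum (λ w → (c u ℤ.- c w) ℤ.* flow u w) ℤ.+ sum (gap u))
      ≡⟨ cong (λ x → E ℤ.+ x) (sum-cong-≗ (λ u → trans
           (sym (∑-distrib-+ (λ w → (c u ℤ.- c w) ℤ.* flow u w) (gap u)))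
           (trans (sum-cong-≗ (cancel u)) (sum-zero n)))) ⟩
    E ℤ.+ sum {n} (const 0ℤ)
      ≡⟨ cong (λ x → E ℤ.+ x) (sum-zero n) ⟩
    E ℤ.+ 0ℤ
      ≡⟨ ℤ.+-identityʳ E ⟩
    E ∎
    where
    open ≡-Reasoning
    E : ℤ
    E = energy c ℤ.+ energy change
    -- The cross term stays in the form `x * d + x * d`, the shape of the left side of
    -- `weighted-sum`.
    square : ∀ x d → (x ℤ.+ d) ℤ.* (x ℤ.+ d) ≡ x ℤ.* x ℤ.+ d ℤ.* d ℤ.+ (x ℤ.* d ℤ.+ x ℤ.* d)
    square = solve-∀
    expand : ∀ u → step G c u ℤ.* step G c u
      ≡ c u ℤ.* c u ℤ.+ change u ℤ.* change u ℤ.+ (c u ℤ.* change u ℤ.+ c u ℤ.* change u)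
    expand u rewrite step-change u = square (c u) (change u)
    commute : ∀ x a s → x ℤ.* (a ℤ.* s) ≡ a ℤ.* (x ℤ.* s)
    commute = solve-∀
    opposite : ∀ a x → a ℤ.* ℤ.- x ℤ.+ a ℤ.* x ≡ 0ℤ
    opposite = solve-∀
    cancel : ∀ u w → (c u ℤ.- c w) ℤ.* flow u w ℤ.+ gap u w ≡ 0ℤ
    cancel u w
      rewrite commute (c u ℤ.- c w) (adjacency u w) (comparison (c u) (c w))
            | gap-comparison (c u) (c w)
      = opposite (adjacency u w) (+ ∣ c u ℤ.- c w ∣)

  gap≥0 : ∀ u w → 0ℤ ℤ.≤ gap u w
  gap≥0 u w with does (adj? G u w)
  ... | false = ℤ.≤-refl
  ... | true  = subst (0ℤ ℤ.≤_) (sym (ℤ.*-identityˡ (+ ∣ c u ℤ.- c w ∣))) (+≤+ z≤n)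

  adjacent-gap : ∀ {u w} → Adj G u w → gap u w ≡ + ∣ c u ℤ.- c w ∣
  adjacent-gap {u} {w} uw rewrite dec-true (adj? G u w) uw = ℤ.*-identityˡ (+ ∣ c u ℤ.- c w ∣)

  -- The threshold `n * (n * n)` bounds `energy change`, as each of the `n` changes is at most `n`
  -- in size. A tension above it pays for this gain; a tension below it bounds each gap, every gap
  -- being one of its nonnegative summands.
  dissipates-or-flat : energy (step G c) ℤ.≤ energy c
    ⊎ (∀ {u w} → Adj G u w → ∣ c u ℤ.- c w ∣ ≤ n * (n * n))
  dissipates-or-flat with ℤ.≤-total (+ (n * (n * n))) tension
  ... | inj₁ K≤T = inj₁ (+-cancelʳ-≤ (+ (n * (n * n))) (begin
    energy (step G c) ℤ.+ + (n * (n * n))  ≤⟨ ℤ.+-monoʳ-≤ (energy (step G c)) K≤T ⟩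
    energy (step G c) ℤ.+ tension          ≡⟨ energy-step ⟩
    energy c ℤ.+ energy change             ≤⟨ ℤ.+-monoʳ-≤ (energy c) (energy≤ change ∣change∣≤n) ⟩
    energy c ℤ.+ + (n * (n * n))           ∎))
    where open ℤ.≤-Reasoning
  ... | inj₂ T≤K = inj₂ λ {u} {w} uw → ℤ.drop‿+≤+ (begin
    + ∣ c u ℤ.- c w ∣  ≡⟨ adjacent-gap uw ⟨
    gap u w            ≤⟨ term≤sum (gap u) (gap≥0 u) w ⟩
    sum (gap u)        ≤⟨ term≤sum (λ v → sum (gap v)) (λ v → 0≤sum (gap≥0 v)) u ⟩
    tension            ≤⟨ T≤K ⟩
    + (n * (n * n))    ∎)
    where open ℤ.≤-Reasoning

-- Height bounds for flat configurations.

∣i-k∣≤∣i-j∣+∣j-k∣ : ∀ i j k → ∣ i ℤ.- k ∣ ≤ ∣ i ℤ.- j ∣ + ∣ j ℤ.- k ∣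
∣i-k∣≤∣i-j∣+∣j-k∣ i j k = subst (λ x → ∣ x ∣ ≤ ∣ i ℤ.- j ∣ + ∣ j ℤ.- k ∣)
  (telescope i j k) (ℤ.∣i+j∣≤∣i∣+∣j∣ (i ℤ.- j) (j ℤ.- k))
  where
  telescope : ∀ i j k → (i ℤ.- j) ℤ.+ (j ℤ.- k) ≡ i ℤ.- k
  telescope = solve-∀

-- Triangle inequality along the vertices 0, 1, ..., `u`; the induction removes vertex 0 and
-- restarts from its successor.
telescoping-bound : ∀ {n K} (c : Config (suc n)) →
  (∀ {u w} → LinSucc u w → ∣ c u ℤ.- c w ∣ ≤ K) → ∀ u → ∣ c zero ℤ.- c u ∣ ≤ toℕ u * K
telescoping-bound c c≤K zero rewrite ℤ.+-inverseʳ (c zero) = z≤n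
telescoping-bound {suc n} c c≤K (suc u) = ℕ.≤-trans
  (∣i-k∣≤∣i-j∣+∣j-k∣ (c zero) (c (suc zero)) (c (suc u)))
  (ℕ.+-mono-≤ (c≤K refl) (telescoping-bound (c ∘ suc) (c≤K ∘ cong suc) u))

-- Small gaps keep every height within `n * K` of `c zero`, and the sum pins `c zero` itself: `n`
-- times it equals `sum c` plus the sum of its differences to all heights.
flat-bound : ∀ {n K} (c : Config n) → (∀ {u w} → LinSucc u w → ∣ c u ℤ.- c w ∣ ≤ K) →
  ∀ u → ∣ c u ∣ ≤ ∣ sum c ∣ + n * (n * K) + n * K
flat-bound {suc n} {K} c c≤K u = begin
  ∣ c u ∣                                    ≡⟨ cong ∣_∣ (recentre (c zero) (c u)) ⟨
  ∣ c zero ℤ.- (c zero ℤ.- c u) ∣            ≤⟨ ℤ.∣i-j∣≤∣i∣+∣j∣ (c zero) _ ⟩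
  ∣ c zero ∣ + ∣ c zero ℤ.- c u ∣            ≤⟨ ℕ.+-mono-≤ c₀-bound (from-zero u) ⟩
  ∣ sum c ∣ + suc n * (suc n * K) + suc n * K ∎
  where
  open ℕ.≤-Reasoning
  recentre : ∀ x y → x ℤ.- (x ℤ.- y) ≡ y
  recentre = solve-∀
  split : ∀ x y → y ℤ.+ (x ℤ.- y) ≡ x
  split = solve-∀
  from-zero : ∀ w → ∣ c zero ℤ.- c w ∣ ≤ suc n * K
  from-zero w = ℕ.≤-trans (telescoping-bound c c≤K w) (ℕ.*-monoˡ-≤ K (ℕ.<⇒≤ (toℕ<n w)))
  sum-split : + suc n ℤ.* c zero ≡ sum c ℤ.+ sum (λ w → c zero ℤ.- c w)
  sum-split = trans (sym (sum-const (suc n) (c zero)))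
    (trans (sum-cong-≗ (λ w → sym (split (c zero) (c w)))) (∑-distrib-+ c (λ w → c zero ℤ.- c w)))
  c₀-bound : ∣ c zero ∣ ≤ ∣ sum c ∣ + suc n * (suc n * K)
  c₀-bound = begin
    ∣ c zero ∣                                      ≤⟨ ℕ.m≤m+n ∣ c zero ∣ _ ⟩
    suc n * ∣ c zero ∣                              ≡⟨ ℤ.abs-* (+ suc n) (c zero) ⟨
    ∣ + suc n ℤ.* c zero ∣                          ≡⟨ cong ∣_∣ sum-split ⟩
    ∣ sum c ℤ.+ sum (λ w → c zero ℤ.- c w) ∣        ≤⟨ ℤ.∣i+j∣≤∣i∣+∣j∣ (sum c) _ ⟩
    ∣ sum c ∣ + ∣ sum (λ w → c zero ℤ.- c w) ∣      ≤⟨ ℕ.+-monoʳ-≤ ∣ sum c ∣ (∣sum∣≤ (λ w → c zero ℤ.- c w) from-zero) ⟩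
    ∣ sum c ∣ + suc n * (suc n * K)                 ∎

-- Boundedness of the orbit when the vertex order is a Hamiltonian path.

module Orbit {n} (G : SimpleGraph n) (traceable : ∀ {u w} → LinSucc u w → Adj G u w) (c₀ : Config n) where

  -- `flatHeight` is the bound of `flat-bound` at `K = n * (n * n)`, `stepHeight` allows for one
  -- further step, and `maxEnergy` covers both the start and any configuration that directly follows
  -- a flat one.
  flatHeight stepHeight maxEnergy : ℕ
  flatHeight = ∣ sum c₀ ∣ + n * (n * (n * (n * n))) + n * (n * (n * n))
  stepHeight = flatHeight + n
  maxEnergy  = ∣ energy c₀ ∣ ⊔ n * (stepHeight * stepHeight)

  sum-diffusion : ∀ t → sum (diffusion G c₀ t) ≡ sum c₀
  sum-diffusion zero    = refl
  sum-diffusion (suc t) = trans (Step.sum-step G (diffusion G c₀ t)) (sum-diffusion t)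

  -- A dissipating step preserves the bound inherited from time `t`; a step from a flat
  -- configuration meets it afresh, by a bound independent of `t`.
  energy-diffusion : ∀ t → energy (diffusion G c₀ t) ℤ.≤ + maxEnergy
  energy-diffusion zero    = ℤ.≤-trans (i≤+∣i∣ (energy c₀)) (+≤+ (ℕ.m≤m⊔n ∣ energy c₀ ∣ _))
  energy-diffusion (suc t) with Step.dissipates-or-flat G (diffusion G c₀ t)
  ... | inj₁ E≤ = ℤ.≤-trans E≤ (energy-diffusion t)
  ... | inj₂ flat = ℤ.≤-trans (energy≤ (step G c) step-bound) (+≤+ (ℕ.m≤n⊔m ∣ energy c₀ ∣ _))
    where
    c : Config n
    c = diffusion G c₀ t
    -- Conservation of chips replaces the sum at time `t` by the initial one.
    c-bound : ∀ u → ∣ c u ∣ ≤ flatHeight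
    c-bound = subst (λ s → ∀ u → ∣ c u ∣ ≤ ∣ s ∣ + n * (n * (n * (n * n))) + n * (n * (n * n)))
      (sum-diffusion t) (flat-bound c (flat ∘ traceable))
    step-bound : ∀ u → ∣ step G c u ∣ ≤ stepHeight
    step-bound u rewrite Step.step-change G c u = ℕ.≤-trans
      (ℤ.∣i+j∣≤∣i∣+∣j∣ (c u) _) (ℕ.+-mono-≤ (c-bound u) (Step.∣change∣≤n G c u))

  diffusion-bounded : ∀ t u → ∣ diffusion G c₀ t u ∣ ≤ maxEnergy
  diffusion-bounded t = ∣c∣≤energy (diffusion G c₀ t) (energy-diffusion t)

-- Finitely many bounded configurations, and the pigeonhole principle.

module Encoding (M : ℕ) where

  shift< : ∀ {i} → ∣ i ∣ ≤ M → ∣ i ℤ.+ + M ∣ < suc (M + M)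
  shift< {i} i≤M = s≤s (ℕ.≤-trans (ℤ.∣i+j∣≤∣i∣+∣j∣ i (+ M)) (ℕ.+-monoˡ-≤ M i≤M))

  0≤shift : ∀ {i} → ∣ i ∣ ≤ M → 0ℤ ℤ.≤ i ℤ.+ + M
  0≤shift {+ n}        _   = +≤+ z≤n
  0≤shift {ℤ.-[1+ n ]} i≤M = subst (0ℤ ℤ.≤_) (ℤ.+-comm (+ M) ℤ.-[1+ n ]) (ℤ.i≤j⇒0≤j-i (+≤+ i≤M))

  -- Shifted by `M`, the heights lie between 0 and `M + M`, so a configuration is a numeral with `n`
  -- digits in base `suc (M + M)`.
  encode : ∀ {n} (c : Config n) → (∀ u → ∣ c u ∣ ≤ M) → Fin (suc (M + M) ^ n)
  encode c c≤M = funToFin (λ u → fromℕ< (shift< {c u} (c≤M u)))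

  encode-injective : ∀ {n} (c c′ : Config n) (p : ∀ u → ∣ c u ∣ ≤ M) (q : ∀ u → ∣ c′ u ∣ ≤ M) →
    encode c p ≡ encode c′ q → c ≗ c′
  encode-injective c c′ p q eq u = +-cancelʳ (+ M) (c u) (c′ u) (begin
    -- Shifted heights are nonnegative, so taking absolute values loses nothing.
    c u ℤ.+ + M            ≡⟨ ℤ.0≤i⇒+∣i∣≡i (0≤shift {c u} (p u)) ⟨
    + ∣ c u ℤ.+ + M ∣      ≡⟨ cong +_ (fromℕ<-injective _ _ (shift< {c u} (p u)) (shift< {c′ u} (q u)) digits) ⟩
    + ∣ c′ u ℤ.+ + M ∣     ≡⟨ ℤ.0≤i⇒+∣i∣≡i (0≤shift {c′ u} (q u)) ⟩
    c′ u ℤ.+ + M           ∎)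
    where
    open ≡-Reasoning
    digits : fromℕ< (shift< {c u} (p u)) ≡ fromℕ< (shift< {c′ u} (q u))
    digits = trans (sym (finToFun-funToFin _ u)) (trans (cong (λ k → finToFun k u) eq) (finToFun-funToFin _ u))

bounded⇒repeats : ∀ {n} M (c : ℕ → Config n) → (∀ t u → ∣ c t u ∣ ≤ M) →
  ∃[ t ] ∃[ p ] (p ≥ 1 × c (t + p) ≗ c t)
bounded⇒repeats {n} M c c≤M
  -- There is one more time than there are codes; the period is the distance between two times with
  -- equal codes.
  with i , j , i<j , eq ← pigeonhole (ℕ.n<1+n (suc (M + M) ^ n)) (λ k → Encoding.encode M (c (toℕ k)) (c≤M (toℕ k)))
  = toℕ i , toℕ j ∸ toℕ i , ℕ.m<n⇒0<n∸m i<j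
  , subst (λ s → c s ≗ c (toℕ i)) (sym (ℕ.m+[n∸m]≡n (ℕ.<⇒≤ i<j)))
      (λ u → sym (Encoding.encode-injective M (c (toℕ i)) (c (toℕ j)) (c≤M (toℕ i)) (c≤M (toℕ j)) eq u))

-- The only place where the shape of the graph enters: in both families consecutive numbers are
-- adjacent.
pathOrCycle-traceable : ∀ {n} {G : SimpleGraph n} → PathOrCycle G → ∀ {u w} → LinSucc u w → Adj G u w
pathOrCycle-traceable (isPath _)  uw = inj₁ uw
pathOrCycle-traceable (isCycle _) uw = inj₁ (inj₁ uw)

theorem7 : ∀ {n : ℕ} (G : SimpleGraph n) → PathOrCycle G → (c₀ : Config n) →
    ∃[ t ] ∃[ p ] (p ≥ 1 × diffusion G c₀ (t + p) ≗ diffusion G c₀ t)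
theorem7 G pc c₀ = bounded⇒repeats maxEnergy (diffusion G c₀) diffusion-bounded
  where open Orbit G (pathOrCycle-traceable pc) c₀
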